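{- For every integer $\ell\geq 1$ there is a first-order prenex sentence $\sigma_\ell$ over $\tau_{\mathsf{ord}}$ with exactly $q^*(\ell)$ quantifiers that separates $L_{\leq\ell}$ from $L_{>\ell}$, and whose quantifier prefix strictly alternates between $\exists$ and $\forall$ and ends with $\forall$.
   Context: Vocabulary $\tau_{\mathsf{ord}} = \langle < ;\ \mathsf{min}, \mathsf{max}\rangle$ with $<$ binary and $\mathsf{min},\mathsf{max}$ constants. For $\ell \geq 1$, $L_\ell$ is the linear order with $\ell+1$ elements (its length is $\ell$), with $\mathsf{min},\mathsf{max}$ interpreted as first and last elements. $L_{\leq \ell}=\{L_1,\dots,L_\ell\}$, $L_{>\ell}=\{L_m: m>\ell\}$. A sentence separates $\mathcal{A}$ from $\mathcal{B}$ if it is true in all structures of $\mathcal{A}$ and false in all of $\mathcal{B}$. Define $q^*_\forall, q^*_\exists : \mathbb{Z}_{\geq 1}\to\mathbb{N}$ by $q^*_\forall(1)=1$, $q^*_\exists(1)=2$, $q^*_\forall(2)=2$, and $q^*_\exists(2\ell) = q^*_\forall(\ell)+1$ ($\ell\geq 1$); $q^*_\exists(2\ell+1) = q^*_\forall(\ell+1)+1$ ($\ell \geq 1$); $q^*_\forall(2\ell) = q^*_\exists(\ell)+1$ ($\ell\geq 2$); $q^*_\forall(2\ell+1) = q^*_\exists(\ell)+1$ ($\ell\geq 1$). Let $q^*(\ell) = \min(q^*_\exists(\ell), q^*_\forall(\ell))$. -}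

module Defs where

open import Data.Fin as Fin using (Fin; fromℕ)
open import Data.List using (List; []; _∷_)
open import Data.Nat using (ℕ; zero; suc; _+_; _*_; _⊓_; _≤_; _<_; _>_; z≤n; s≤s; ⌊_/2⌋; ⌈_/2⌉)
open import Data.Nat.Induction using (Acc; acc; <-wellFounded)
open import Data.Nat.Properties
  using (⌊n/2⌋<n; ⌈n/2⌉<n; n≡⌊n+n/2⌋; n≡⌈n+n/2⌉; +-comm; +-identityʳ; *-monoʳ-≤; ≤-trans; m≤m+n)
open import Data.Product using (Σ-syntax; ∃-syntax; _×_)
open import Data.Sum using (_⊎_)
open import Data.Vec using (Vec; []; _∷_; lookup)
open import Level using (0ℓ) renaming (suc to lsuc)
open import Relation.Binary.Core using (Rel)
open import Relation.Binary.PropositionalEquality using (_≡_; refl; sym; trans; cong)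
open import Relation.Nullary using (¬_)
open import Relation.Unary using (Pred)

-- First-order logic with equality over ⟨ < ; min , max ⟩.
-- Formula n has its free variables among n de Bruijn indices.

data Quantifier : Set where
  ∃ᑫ ∀ᑫ : Quantifier

data Term (n : ℕ) : Set where
  var     : Fin n → Term n
  minᵗ maxᵗ : Term n

infix  8 _≺_ _≐_
infix  7 ¬′_
infixr 6 _∧′_
infixr 5 _∨′_

data Formula (n : ℕ) : Set where
  _≺_ _≐_   : Term n → Term n → Formula n
  ¬′_       : Formula n → Formula n
  _∧′_ _∨′_ : Formula n → Formula n → Formula n
  quant     : Quantifier → Formula (suc n) → Formula n

Sentence : Set
Sentence = Formula 0

#quantifiers : ∀ {n} → Formula n → ℕ
#quantifiers (s ≺ t)     = 0
#quantifiers (s ≐ t)     = 0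
#quantifiers (¬′ φ)      = #quantifiers φ
#quantifiers (φ ∧′ ψ)    = #quantifiers φ + #quantifiers ψ
#quantifiers (φ ∨′ ψ)    = #quantifiers φ + #quantifiers ψ
#quantifiers (quant q φ) = suc (#quantifiers φ)

data QuantifierFree {n : ℕ} : Formula n → Set where
  ≺-qf : ∀ {s t} → QuantifierFree (s ≺ t)
  ≐-qf : ∀ {s t} → QuantifierFree (s ≐ t)
  ¬-qf : ∀ {φ} → QuantifierFree φ → QuantifierFree (¬′ φ)
  ∧-qf : ∀ {φ ψ} → QuantifierFree φ → QuantifierFree ψ → QuantifierFree (φ ∧′ ψ)
  ∨-qf : ∀ {φ ψ} → QuantifierFree φ → QuantifierFree ψ → QuantifierFree (φ ∨′ ψ)

-- Prenex Q φ: φ is in prenex form and Q is its quantifier prefix, outermost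
-- quantifier first.
data Prenex {n : ℕ} : List Quantifier → Formula n → Set where
  matrix : ∀ {φ} → QuantifierFree φ → Prenex [] φ
  prefix : ∀ {q Q φ} → Prenex Q φ → Prenex (q ∷ Q) (quant q φ)

record OrdStructure : Set₁ where
  field
    Carrier : Set
    _<ˢ_    : Rel Carrier 0ℓ
    minˢ    : Carrier
    maxˢ    : Carrier

module _ (A : OrdStructure) where
  open OrdStructure A

  ⟦_⟧ᵗ : ∀ {n} → Term n → Vec Carrier n → Carrier
  ⟦ var i ⟧ᵗ ρ = lookup ρ i
  ⟦ minᵗ ⟧ᵗ  ρ = minˢ
  ⟦ maxᵗ ⟧ᵗ  ρ = maxˢ

  ⟦_⟧ : ∀ {n} → Formula n → Vec Carrier n → Set
  ⟦ s ≺ t ⟧      ρ = ⟦ s ⟧ᵗ ρ <ˢ ⟦ t ⟧ᵗ ρ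
  ⟦ s ≐ t ⟧      ρ = ⟦ s ⟧ᵗ ρ ≡ ⟦ t ⟧ᵗ ρ
  ⟦ ¬′ φ ⟧       ρ = ¬ ⟦ φ ⟧ ρ
  ⟦ φ ∧′ ψ ⟧     ρ = ⟦ φ ⟧ ρ × ⟦ ψ ⟧ ρ
  ⟦ φ ∨′ ψ ⟧     ρ = ⟦ φ ⟧ ρ ⊎ ⟦ ψ ⟧ ρ
  ⟦ quant ∃ᑫ φ ⟧ ρ = Σ[ a ∈ Carrier ] ⟦ φ ⟧ (a ∷ ρ)
  ⟦ quant ∀ᑫ φ ⟧ ρ = (a : Carrier) → ⟦ φ ⟧ (a ∷ ρ)

infix 4 _⊨_

_⊨_ : OrdStructure → Sentence → Set
A ⊨ σ = ⟦_⟧ A σ []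

Separates : Sentence → (𝒜 ℬ : Pred OrdStructure (lsuc 0ℓ)) → Set₁
Separates σ 𝒜 ℬ = (∀ A → 𝒜 A → A ⊨ σ) × (∀ B → ℬ B → ¬ B ⊨ σ)

-- The length ℓ counts the steps of the order, so L ℓ has ℓ + 1 elements.
L : ℕ → OrdStructure
L ℓ = record
  { Carrier = Fin (suc ℓ)
  ; _<ˢ_    = Fin._<_
  ; minˢ    = Fin.zero
  ; maxˢ    = fromℕ ℓ
  }

L≤ : ℕ → Pred OrdStructure (lsuc 0ℓ)
L≤ ℓ A = ∃[ m ] 1 ≤ m × m ≤ ℓ × A ≡ L m

L> : ℕ → Pred OrdStructure (lsuc 0ℓ)
L> ℓ A = ∃[ m ] m > ℓ × A ≡ L m

-- The two mutually recursive functions q*∃ and q*∀ on the positive integers.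
-- The even and odd clauses are merged by halving (rounding up in q*∃ and down
-- in q*∀); the separate clauses are recovered in the lemmas below.  The value
-- at 0 is junk.
mutual
  q*∃-acc : ∀ n → Acc _<_ n → ℕ
  q*∃-acc 0             _        = 0
  q*∃-acc 1             _        = 2
  q*∃-acc (suc (suc n)) (acc rs) =
    q*∀-acc ⌈ suc (suc n) /2⌉ (rs (⌈n/2⌉<n n)) + 1

  q*∀-acc : ∀ n → Acc _<_ n → ℕ
  q*∀-acc 0                   _        = 0
  q*∀-acc 1                   _        = 1
  q*∀-acc 2                   _        = 2
  q*∀-acc (suc (suc (suc n))) (acc rs) =
    q*∃-acc ⌊ suc (suc (suc n)) /2⌋ (rs (⌊n/2⌋<n (suc (suc n)))) + 1

q*∃ q*∀ q* : ℕ → ℕ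
q*∃ n = q*∃-acc n (<-wellFounded n)
q*∀ n = q*∀-acc n (<-wellFounded n)
q*  n = q*∃ n ⊓ q*∀ n

mutual
  q*∃-acc-irrelevant : ∀ n (a b : Acc _<_ n) → q*∃-acc n a ≡ q*∃-acc n b
  q*∃-acc-irrelevant 0             _        _         = refl
  q*∃-acc-irrelevant 1             _        _         = refl
  q*∃-acc-irrelevant (suc (suc n)) (acc rs) (acc rs′) =
    cong (_+ 1) (q*∀-acc-irrelevant _ (rs (⌈n/2⌉<n n)) (rs′ (⌈n/2⌉<n n)))

  q*∀-acc-irrelevant : ∀ n (a b : Acc _<_ n) → q*∀-acc n a ≡ q*∀-acc n b
  q*∀-acc-irrelevant 0                   _        _         = refl
  q*∀-acc-irrelevant 1                   _        _         = refl
  q*∀-acc-irrelevant 2                   _        _         = refl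
  q*∀-acc-irrelevant (suc (suc (suc n))) (acc rs) (acc rs′) =
    cong (_+ 1) (q*∃-acc-irrelevant _ (rs (⌊n/2⌋<n (suc (suc n)))) (rs′ (⌊n/2⌋<n (suc (suc n)))))

q*∃-halve : ∀ n → 2 ≤ n → q*∃ n ≡ q*∀ ⌈ n /2⌉ + 1
q*∃-halve (suc (suc n)) (s≤s (s≤s z≤n)) = cong (_+ 1) (q*∀-acc-irrelevant ⌈ suc (suc n) /2⌉ _ _)

q*∀-halve : ∀ n → 3 ≤ n → q*∀ n ≡ q*∃ ⌊ n /2⌋ + 1
q*∀-halve (suc (suc (suc n))) (s≤s (s≤s (s≤s z≤n))) = cong (_+ 1) (q*∃-acc-irrelevant ⌊ suc (suc (suc n)) /2⌋ _ _)

private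
  2*n≡n+n : ∀ n → 2 * n ≡ n + n
  2*n≡n+n n = cong (n +_) (+-identityʳ n)

  ⌊2n/2⌋≡n : ∀ n → ⌊ 2 * n /2⌋ ≡ n
  ⌊2n/2⌋≡n n = trans (cong ⌊_/2⌋ (2*n≡n+n n)) (sym (n≡⌊n+n/2⌋ n))

  ⌈2n/2⌉≡n : ∀ n → ⌈ 2 * n /2⌉ ≡ n
  ⌈2n/2⌉≡n n = trans (cong ⌈_/2⌉ (2*n≡n+n n)) (sym (n≡⌈n+n/2⌉ n))

  ⌈2n+1/2⌉≡n+1 : ∀ n → ⌈ 2 * n + 1 /2⌉ ≡ n + 1
  ⌈2n+1/2⌉≡n+1 n = trans (cong ⌈_/2⌉ (+-comm (2 * n) 1))
                  (trans (cong suc (⌊2n/2⌋≡n n)) (+-comm 1 n))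

  ⌊2n+1/2⌋≡n : ∀ n → ⌊ 2 * n + 1 /2⌋ ≡ n
  ⌊2n+1/2⌋≡n n = trans (cong ⌊_/2⌋ (+-comm (2 * n) 1)) (⌈2n/2⌉≡n n)

  3≤2n+1 : ∀ n → 1 ≤ n → 3 ≤ 2 * n + 1
  3≤2n+1 n p rewrite +-comm (2 * n) 1 = s≤s (*-monoʳ-≤ 2 p)

q*∃-1 : q*∃ 1 ≡ 2
q*∃-1 = refl

q*∀-1 : q*∀ 1 ≡ 1
q*∀-1 = refl

q*∀-2 : q*∀ 2 ≡ 2
q*∀-2 = refl

q*∃-even : ∀ ℓ → 1 ≤ ℓ → q*∃ (2 * ℓ) ≡ q*∀ ℓ + 1
q*∃-even ℓ p = trans (q*∃-halve (2 * ℓ) (*-monoʳ-≤ 2 p))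
                     (cong (λ k → q*∀ k + 1) (⌈2n/2⌉≡n ℓ))

q*∃-odd : ∀ ℓ → 1 ≤ ℓ → q*∃ (2 * ℓ + 1) ≡ q*∀ (ℓ + 1) + 1
q*∃-odd ℓ p = trans (q*∃-halve (2 * ℓ + 1) (≤-trans (*-monoʳ-≤ 2 p) (m≤m+n (2 * ℓ) 1)))
                    (cong (λ k → q*∀ k + 1) (⌈2n+1/2⌉≡n+1 ℓ))

q*∀-even : ∀ ℓ → 2 ≤ ℓ → q*∀ (2 * ℓ) ≡ q*∃ ℓ + 1
q*∀-even ℓ p = trans (q*∀-halve (2 * ℓ) (≤-trans (s≤s (s≤s (s≤s z≤n))) (*-monoʳ-≤ 2 p)))
                     (cong (λ k → q*∃ k + 1) (⌊2n/2⌋≡n ℓ))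

q*∀-odd : ∀ ℓ → 1 ≤ ℓ → q*∀ (2 * ℓ + 1) ≡ q*∃ ℓ + 1
q*∀-odd ℓ p = trans (q*∀-halve (2 * ℓ + 1) (3≤2n+1 ℓ p))
                    (cong (λ k → q*∃ k + 1) (⌊2n+1/2⌋≡n ℓ))

{-# OPTIONS --safe #-}
module Submission where

-- With lengths of intervals written additively, b ≤ i + j + a holds iff some z
-- has z ≤ i + a and b ≤ j + z, and b ≤ suc (i + j) + a holds iff every y has
-- y ≤ i + a or b ≤ j + y.  Alternating the two splits, an ∃ asks for a
-- conjunction of two bounds and a ∀ for a disjunction of two bounds.  Neither
-- connective costs a quantifier: the variable quantified next lies on one side
-- of the splitting point, and its side selects the conjunct or disjunct it is
-- about.  So each ∃ doubles the bound and each ∀ sends c to 1 + 2 c.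

open import Defs
open import Data.Bool using (Bool; true; false)
open import Data.Empty using (⊥-elim)
open import Data.Fin using (Fin; zero; suc; toℕ; fromℕ<)
open import Data.Fin.Properties using (toℕ<n; toℕ-fromℕ; toℕ-fromℕ<)
open import Data.List using (List; []; _∷_; last; length)
open import Data.List.Relation.Unary.Linked using (Linked; [-]; _∷_)
open import Data.Maybe using (just)
open import Data.Nat using (ℕ; zero; suc; _+_; _*_; _⊓_; _⊔_; _≤_; _<_; z≤n; s≤s; ⌊_/2⌋; ⌈_/2⌉; _<?_)
open import Data.Nat.Induction using (<-rec)
open import Data.Nat.Properties
open import Data.Product using (∃-syntax; Σ-syntax; _×_; _,_; proj₁; proj₂)
open import Data.Sum using (_⊎_; inj₁; inj₂)
open import Data.Vec using (Vec; []; _∷_)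
open import Function using (_∘_; _⇔_; mk⇔; Equivalence)
open import Relation.Binary.PropositionalEquality
  using (_≡_; _≢_; refl; sym; trans; cong; cong₂; subst; subst₂)
open import Relation.Nullary using (¬_; yes; no; contradiction)

open Equivalence using (to; from)

-- Prenex formulas with a given prefix

PrenexFormula : List Quantifier → ℕ → Set
PrenexFormula Q n = Σ[ φ ∈ Formula n ] Prenex Q φ

quantify : ∀ {Q n} q → PrenexFormula Q (suc n) → PrenexFormula (q ∷ Q) n
quantify q (φ , p) = quant q φ , prefix p

#quantifiers-qf : ∀ {n} {φ : Formula n} → QuantifierFree φ → #quantifiers φ ≡ 0
#quantifiers-qf ≺-qf       = refl
#quantifiers-qf ≐-qf       = refl
#quantifiers-qf (¬-qf p)   = #quantifiers-qf p
#quantifiers-qf (∧-qf p r) = cong₂ _+_ (#quantifiers-qf p) (#quantifiers-qf r)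
#quantifiers-qf (∨-qf p r) = cong₂ _+_ (#quantifiers-qf p) (#quantifiers-qf r)

#quantifiers-prenex : ∀ {Q n} {φ : Formula n} → Prenex Q φ → #quantifiers φ ≡ length Q
#quantifiers-prenex (matrix p) = #quantifiers-qf p
#quantifiers-prenex (prefix p) = cong suc (#quantifiers-prenex p)

weaken : ∀ {n} → Term n → Term (suc n)
weaken (var i) = var (suc i)
weaken minᵗ    = minᵗ
weaken maxᵗ    = maxᵗ

-- The dummy quantifiers give a trivial branch the prefix of its sibling, as `if_≺_then_else_`
-- demands.
constant : ∀ {n} → Bool → ∀ Q → PrenexFormula Q n
constant true  []      = ¬′ minᵗ ≺ minᵗ , matrix (¬-qf ≺-qf)
constant false []      = minᵗ ≺ minᵗ , matrix ≺-qf
constant true  (q ∷ Q) = quantify q (constant true Q)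
constant false (q ∷ Q) = quantify q (constant false Q)

-- Opacity lets the branches be inferred from an occurrence of if_≺_then_else_.
opaque
  if_≺_then_else_ : ∀ {Q n} → Term n → Term n →
                    PrenexFormula Q n → PrenexFormula Q n → PrenexFormula Q n
  if s ≺ t then (φ , matrix p) else (ψ , matrix r) =
    (s ≺ t ∧′ φ) ∨′ (¬′ s ≺ t ∧′ ψ) , matrix (∨-qf (∧-qf ≺-qf p) (∧-qf (¬-qf ≺-qf) r))
  if s ≺ t then (quant q φ , prefix p) else (quant _ ψ , prefix r) =
    quantify q (if weaken s ≺ weaken t then (φ , p) else (ψ , r))

module _ (A : OrdStructure) where
  open OrdStructure A

  weaken-value : ∀ {n} (t : Term n) {x} {ρ : Vec Carrier n} →
                 ⟦_⟧ᵗ A (weaken t) (x ∷ ρ) ≡ ⟦_⟧ᵗ A t ρ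
  weaken-value (var i) = refl
  weaken-value minᵗ    = refl
  weaken-value maxᵗ    = refl

  quant-cong : ∀ q {n} {φ ψ : Formula (suc n)} {ρ : Vec Carrier n} →
               (∀ x → ⟦_⟧ A φ (x ∷ ρ) ⇔ ⟦_⟧ A ψ (x ∷ ρ)) →
               ⟦_⟧ A (quant q φ) ρ ⇔ ⟦_⟧ A (quant q ψ) ρ
  quant-cong ∃ᑫ e = mk⇔ (λ (x , p) → x , to (e x) p) (λ (x , p) → x , from (e x) p)
  quant-cong ∀ᑫ e = mk⇔ (λ p x → to (e x) (p x)) (λ p x → from (e x) (p x))

  opaque
    unfolding if_≺_then_else_

    -- The test never mentions the variables of the merged prefix, so it has one truth value for all
    -- their values, and each merged quantifier acts as that of the selected branch.
    if-true : ∀ {Q n} {s t : Term n} (φ ψ : PrenexFormula Q n) {ρ} → ⟦_⟧ A (s ≺ t) ρ →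
              ⟦_⟧ A (proj₁ φ) ρ ⇔ ⟦_⟧ A (proj₁ (if s ≺ t then φ else ψ)) ρ
    if-true (φ , matrix p) (ψ , matrix r) s<t =
      mk⇔ (λ x → inj₁ (s<t , x))
          (λ { (inj₁ (_ , x)) → x ; (inj₂ (s≮t , _)) → contradiction s<t s≮t })
    if-true {s = s} {t} (quant q φ , prefix p) (quant _ ψ , prefix r) s<t =
      quant-cong q (λ x → if-true (φ , p) (ψ , r)
        (subst₂ _<ˢ_ (sym (weaken-value s)) (sym (weaken-value t)) s<t))

    if-false : ∀ {Q n} {s t : Term n} (φ ψ : PrenexFormula Q n) {ρ} → ¬ ⟦_⟧ A (s ≺ t) ρ →
               ⟦_⟧ A (proj₁ ψ) ρ ⇔ ⟦_⟧ A (proj₁ (if s ≺ t then φ else ψ)) ρ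
    if-false (φ , matrix p) (ψ , matrix r) s≮t =
      mk⇔ (λ x → inj₂ (s≮t , x))
          (λ { (inj₁ (s<t , _)) → contradiction s<t s≮t ; (inj₂ (_ , x)) → x })
    if-false {s = s} {t} (quant q φ , prefix p) (quant _ ψ , prefix r) s≮t =
      quant-cong q (λ x → if-false (φ , p) (ψ , r)
        (s≮t ∘ subst₂ _<ˢ_ (weaken-value s) (weaken-value t)))

  constant-true : ¬ minˢ <ˢ minˢ → ∀ Q {n} {ρ : Vec Carrier n} →
                  ⟦_⟧ A (proj₁ (constant true Q)) ρ
  constant-true irr []       = irr
  constant-true irr (∃ᑫ ∷ Q) = minˢ , constant-true irr Q
  constant-true irr (∀ᑫ ∷ Q) = λ _ → constant-true irr Q

  constant-false : ¬ minˢ <ˢ minˢ → ∀ Q {n} {ρ : Vec Carrier n} →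
                   ¬ ⟦_⟧ A (proj₁ (constant false Q)) ρ
  constant-false irr []       = irr
  constant-false irr (∃ᑫ ∷ Q) = λ (_ , p) → constant-false irr Q p
  constant-false irr (∀ᑫ ∷ Q) = λ p → constant-false irr Q (p minˢ)

-- Alternating prefixes and the formulas bounding lengths

mutual
  [∃∀]^_ ∀[∃∀]^_ : ℕ → List Quantifier
  [∃∀]^ zero  = []
  [∃∀]^ suc m = ∃ᑫ ∷ ∀[∃∀]^ m
  ∀[∃∀]^ m    = ∀ᑫ ∷ [∃∀]^ m

∀[∃∀]-linked : ∀ m → Linked _≢_ (∀[∃∀]^ m)
∀[∃∀]-linked zero    = [-]
∀[∃∀]-linked (suc m) = (λ ()) ∷ (λ ()) ∷ ∀[∃∀]-linked m

∀[∃∀]-last : ∀ m → last (∀[∃∀]^ m) ≡ just ∀ᑫ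
∀[∃∀]-last zero    = refl
∀[∃∀]-last (suc m) = ∀[∃∀]-last m

∀[∃∀]-length : ∀ m → length (∀[∃∀]^ m) ≡ suc (m * 2)
∀[∃∀]-length zero    = refl
∀[∃∀]-length (suc m) = cong (2 +_) (∀[∃∀]-length m)

-- For i and j within the capacity of m, bothShort m i j a x b says that
-- x ≤ i + a and b ≤ j + x; oneShort m i j a y b says, when y < b, that
-- y ≤ i + a or b ≤ j + y; and shortThrough m i a y b is the instance at y < b
-- of the ∀-split of b ≤ i + a.  A ∀-split needs i ≢ 0, whence its first clause.
mutual
  oneShort : ∀ m {n} (i j : ℕ) (a y b : Term n) → PrenexFormula ([∃∀]^ m) n
  oneShort zero    i j a y b =
    ¬′ (a ≺ y ∧′ y ≺ b) , matrix (¬-qf (∧-qf ≺-qf ≺-qf))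
  oneShort (suc m) i j a y b = quantify ∃ᑫ
    (if weaken y ≺ var zero
     then bothShort m ⌈ j /2⌉ ⌊ j /2⌋ (weaken y) (var zero) (weaken b)
     else bothShort m ⌈ i /2⌉ ⌊ i /2⌋ (weaken a) (var zero) (weaken y))

  bothShort : ∀ m {n} (i j : ℕ) (a x b : Term n) → PrenexFormula (∀[∃∀]^ m) n
  bothShort m i j a x b = quantify ∀ᑫ
    (if var zero ≺ weaken x
     then shortThrough m i (weaken a) (var zero) (weaken x)
     else if var zero ≺ weaken b
     then shortThrough m j (weaken x) (var zero) (weaken b)
     else constant true ([∃∀]^ m))

  shortThrough : ∀ m {n} (i : ℕ) (a y b : Term n) → PrenexFormula ([∃∀]^ m) n
  shortThrough m zero    a y b =
    if a ≺ b then constant false ([∃∀]^ m) else constant true ([∃∀]^ m)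
  shortThrough m (suc i) a y b = oneShort m ⌈ i /2⌉ ⌊ i /2⌋ a y b

capacity : ℕ → ℕ
capacity zero    = 0
capacity (suc m) = 2 * (1 + 2 * capacity m)

-- Arithmetic of halving a bound

⌈n/2⌉≤ : ∀ {n k} → n ≤ 2 * k → ⌈ n /2⌉ ≤ k
⌈n/2⌉≤ {n} {k} p = ≤-trans (⌈n/2⌉-mono p)
  (≤-reflexive (trans (cong ⌈_/2⌉ (cong (k +_) (+-identityʳ k))) (sym (n≡⌈n+n/2⌉ k))))

⌊n/2⌋≤ : ∀ {n k} → n ≤ 2 * k → ⌊ n /2⌋ ≤ k
⌊n/2⌋≤ {n} p = ≤-trans (⌊n/2⌋≤⌈n/2⌉ n) (⌈n/2⌉≤ p)

halves-+ : ∀ i a → ⌊ i /2⌋ + (⌈ i /2⌉ + a) ≡ i + a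
halves-+ i a = trans (sym (+-assoc ⌊ i /2⌋ ⌈ i /2⌉ a)) (cong (_+ a) (⌊n/2⌋+⌈n/2⌉≡n i))

-- The splitting point is as far as the first half reaches from `a`, capped at `b` so that it stays
-- an element of the order.
split-∃ : ∀ {i a b} → b ≤ i + a → b ≤ ⌊ i /2⌋ + ((⌈ i /2⌉ + a) ⊓ b)
split-∃ {i} {a} {b} b≤ = begin
  b                                                     ≤⟨ ⊓-glb b≤ (m≤n+m b ⌊ i /2⌋) ⟩
  (i + a) ⊓ (⌊ i /2⌋ + b)                               ≡⟨ cong (_⊓ (⌊ i /2⌋ + b)) (halves-+ i a) ⟨
  (⌊ i /2⌋ + (⌈ i /2⌉ + a)) ⊓ (⌊ i /2⌋ + b)             ≡⟨ +-distribˡ-⊓ ⌊ i /2⌋ (⌈ i /2⌉ + a) b ⟨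
  ⌊ i /2⌋ + ((⌈ i /2⌉ + a) ⊓ b)                         ∎
  where open ≤-Reasoning

join-∃ : ∀ {i a z b} → z ≤ ⌈ i /2⌉ + a → b ≤ ⌊ i /2⌋ + z → b ≤ i + a
join-∃ {i} {a} z≤ b≤ =
  ≤-trans b≤ (≤-trans (+-monoʳ-≤ ⌊ i /2⌋ z≤) (≤-reflexive (halves-+ i a)))

-- The extra unit of a ∀-split: the least point violating the first bound is `suc (⌈ i /2⌉ + a)`,
-- and the second half counts from there.
halves-suc-+ : ∀ i a → ⌊ i /2⌋ + suc (⌈ i /2⌉ + a) ≡ suc i + a
halves-suc-+ i a = trans (+-suc ⌊ i /2⌋ (⌈ i /2⌉ + a)) (cong suc (halves-+ i a))

-- Truth of the bounding formulas in `L N`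

module _ (N : ℕ) where

  Sat : ∀ {Q n} → PrenexFormula Q n → Vec (Fin (suc N)) n → Set
  Sat φ ρ = ⟦_⟧ (L N) (proj₁ φ) ρ

  infix 4 _⊢_⇓_

  -- Naming the values of terms by natural numbers keeps the inequalities in `ℕ` and unchanged when
  -- terms are weakened.
  _⊢_⇓_ : ∀ {n} → Vec (Fin (suc N)) n → Term n → ℕ → Set
  ρ ⊢ t ⇓ α = toℕ (⟦_⟧ᵗ (L N) t ρ) ≡ α

  ⇓-weaken : ∀ {n} {ρ : Vec (Fin (suc N)) n} (t : Term n) {α x} →
             ρ ⊢ t ⇓ α → (x ∷ ρ) ⊢ weaken t ⇓ α
  ⇓-weaken t e = trans (cong toℕ (weaken-value (L N) t)) e

  ⇓-bounded : ∀ {n} {ρ : Vec (Fin (suc N)) n} (t : Term n) {α} → ρ ⊢ t ⇓ α → α < suc N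
  ⇓-bounded t refl = toℕ<n (⟦_⟧ᵗ (L N) t _)

  element : ∀ {k} → k < suc N → Σ[ x ∈ Fin (suc N) ] toℕ x ≡ k
  element k<N = fromℕ< k<N , toℕ-fromℕ< k<N

  module _ {Q n} {ρ : Vec (Fin (suc N)) n} (s t : Term n) (φ ψ : PrenexFormula Q n)
           {α β : ℕ} (s⇓ : ρ ⊢ s ⇓ α) (t⇓ : ρ ⊢ t ⇓ β) where

    if-< : α < β → Sat φ ρ ⇔ Sat (if s ≺ t then φ else ψ) ρ
    if-< α<β = if-true (L N) φ ψ (subst₂ _<_ (sym s⇓) (sym t⇓) α<β)

    if-≮ : ¬ α < β → Sat ψ ρ ⇔ Sat (if s ≺ t then φ else ψ) ρ
    if-≮ α≮β = if-false (L N) φ ψ (α≮β ∘ subst₂ _<_ s⇓ t⇓)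

  -- The right disjunct is used with y < b only, so that the witness of its
  -- ∃-split can be taken above y and is not mistaken for one of the left disjunct.
  mutual
    oneShort-complete :
      ∀ m {n i j} {ρ : Vec (Fin (suc N)) n} (a y b : Term n) {α υ β} →
      ρ ⊢ a ⇓ α → ρ ⊢ y ⇓ υ → ρ ⊢ b ⇓ β → i ≤ capacity m → j ≤ capacity m →
      υ ≤ i + α ⊎ (υ < β × β ≤ j + υ) → Sat (oneShort m i j a y b) ρ
    -- Here `capacity zero` forces `i` and `j` to be 0, and the disjunction says just that `y` is
    -- not strictly between `a` and `b`.
    oneShort-complete zero a y b refl refl refl z≤n z≤n (inj₁ υ≤α) (α<υ , _) = <⇒≱ α<υ υ≤α
    oneShort-complete zero a y b refl refl refl z≤n z≤n (inj₂ (υ<β , β≤υ)) _ = <⇒≱ υ<β β≤υ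
    oneShort-complete (suc m) {i = i} a y b {α} {υ} a⇓ y⇓ b⇓ i≤ j≤ (inj₁ υ≤)
      with element (≤-<-trans (m⊓n≤n (⌈ i /2⌉ + α) υ) (⇓-bounded y y⇓))
    ... | z , z⇓ = z , to
      (if-≮ _ _ _ _ (⇓-weaken y y⇓) z⇓
        (≤⇒≯ (m⊓n≤n (⌈ i /2⌉ + α) υ)))
      (bothShort-complete m ⌈ i /2⌉ ⌊ i /2⌋ (weaken a) (var zero) (weaken y)
        (⇓-weaken a a⇓) z⇓ (⇓-weaken y y⇓) (⌈n/2⌉≤ i≤) (⌊n/2⌋≤ i≤)
        (m⊓n≤m (⌈ i /2⌉ + α) υ) (split-∃ {i} υ≤))
    oneShort-complete (suc m) {j = zero} a y b a⇓ y⇓ b⇓ i≤ j≤ (inj₂ (υ<β , β≤)) =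
      contradiction β≤ (<⇒≱ υ<β)
    oneShort-complete (suc m) {j = j@(suc _)} a y b {υ = υ} {β} a⇓ y⇓ b⇓ i≤ j≤ (inj₂ (υ<β , β≤))
      with element (≤-<-trans (m⊓n≤n (⌈ j /2⌉ + υ) β) (⇓-bounded b b⇓))
    ... | z , z⇓ = z , to
      -- Since `j` is positive, so is `⌈ j /2⌉`, and both arguments of the minimum exceed `υ`.
      (if-< _ _ _ _ (⇓-weaken y y⇓) z⇓
        (⊓-glb (s≤s (m≤n+m υ _)) υ<β))
      (bothShort-complete m ⌈ j /2⌉ ⌊ j /2⌋ (weaken y) (var zero) (weaken b)
        (⇓-weaken y y⇓) z⇓ (⇓-weaken b b⇓) (⌈n/2⌉≤ j≤) (⌊n/2⌋≤ j≤)
        (m⊓n≤m (⌈ j /2⌉ + υ) β) (split-∃ {j} β≤))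

    bothShort-complete :
      ∀ m i j {n} {ρ : Vec (Fin (suc N)) n} (a x b : Term n) {α ξ β} →
      ρ ⊢ a ⇓ α → ρ ⊢ x ⇓ ξ → ρ ⊢ b ⇓ β →
      i ≤ 1 + 2 * capacity m → j ≤ 1 + 2 * capacity m →
      ξ ≤ i + α → β ≤ j + ξ → Sat (bothShort m i j a x b) ρ
    bothShort-complete m i j a x b {ξ = ξ} {β} a⇓ x⇓ b⇓ i≤ j≤ ξ≤ β≤ y with toℕ y <? ξ | toℕ y <? β
    ... | yes y<ξ | _ = to
      (if-< _ _ _ _ refl (⇓-weaken x x⇓) y<ξ)
      (shortThrough-complete m (weaken a) (var zero) (weaken x)
        (⇓-weaken a a⇓) refl (⇓-weaken x x⇓) i≤ y<ξ ξ≤)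
    ... | no y≮ξ | yes y<β = to
      (if-≮ _ _ _ _ refl (⇓-weaken x x⇓) y≮ξ) (to
      (if-< _ _ _ _ refl (⇓-weaken b b⇓) y<β)
      (shortThrough-complete m (weaken x) (var zero) (weaken b)
        (⇓-weaken x x⇓) refl (⇓-weaken b b⇓) j≤ y<β β≤))
    ... | no y≮ξ | no y≮β = to
      (if-≮ _ _ _ _ refl (⇓-weaken x x⇓) y≮ξ) (to
      (if-≮ _ _ _ _ refl (⇓-weaken b b⇓) y≮β)
      (constant-true (L N) (λ ()) ([∃∀]^ m)))

    shortThrough-complete :
      ∀ m {n i} {ρ : Vec (Fin (suc N)) n} (a y b : Term n) {α υ β} →
      ρ ⊢ a ⇓ α → ρ ⊢ y ⇓ υ → ρ ⊢ b ⇓ β → i ≤ 1 + 2 * capacity m →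
      υ < β → β ≤ i + α → Sat (shortThrough m i a y b) ρ
    shortThrough-complete m {i = zero} a y b a⇓ y⇓ b⇓ i≤ υ<β β≤ = to
      (if-≮ a b _ _ a⇓ b⇓ (≤⇒≯ β≤))
      (constant-true (L N) (λ ()) ([∃∀]^ m))
    shortThrough-complete m {i = suc i} a y b {α} {υ} {β} a⇓ y⇓ b⇓ (s≤s i≤) υ<β β≤ =
      oneShort-complete m a y b a⇓ y⇓ b⇓ (⌈n/2⌉≤ i≤) (⌊n/2⌋≤ i≤) cases
      where
      cases : υ ≤ ⌈ i /2⌉ + α ⊎ (υ < β × β ≤ ⌊ i /2⌋ + υ)
      cases with ≤-<-connex υ (⌈ i /2⌉ + α)
      ... | inj₁ υ≤ = inj₁ υ≤
      -- Strictness puts `υ` at `suc (⌈ i /2⌉ + α)` or later, which gains the extra unit.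
      ... | inj₂ <υ = inj₂ (υ<β , ≤-trans β≤
        (≤-trans (≤-reflexive (sym (halves-suc-+ i α))) (+-monoʳ-≤ ⌊ i /2⌋ <υ)))

  mutual
    -- The side of `y` on which the witness lies decides the disjunct, and the two halves add up
    -- through the witness.
    oneShort-sound :
      ∀ m {n i j} {ρ : Vec (Fin (suc N)) n} (a y b : Term n) {α υ β} →
      ρ ⊢ a ⇓ α → ρ ⊢ y ⇓ υ → ρ ⊢ b ⇓ β →
      Sat (oneShort m i j a y b) ρ → υ ≤ i + α ⊎ β ≤ j + υ
    oneShort-sound zero {i = i} {j} a y b {α} {υ} {β} refl refl refl h with α <? υ | υ <? β
    ... | no α≮υ  | _       = inj₁ (≤-trans (≮⇒≥ α≮υ) (m≤n+m α i))
    ... | yes _   | no υ≮β  = inj₂ (≤-trans (≮⇒≥ υ≮β) (m≤n+m υ j))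
    ... | yes α<υ | yes υ<β = ⊥-elim (h (α<υ , υ<β))
    oneShort-sound (suc m) {i = i} {j} a y b {υ = υ} a⇓ y⇓ b⇓ (z , h) with υ <? toℕ z
    ... | yes υ<z
      with z≤ , β≤ ← bothShort-sound m ⌈ j /2⌉ ⌊ j /2⌋ (weaken y) (var zero) (weaken b)
             (⇓-weaken y y⇓) refl (⇓-weaken b b⇓)
             (from (if-< _ _ _ _ (⇓-weaken y y⇓) refl υ<z) h)
      = inj₂ (join-∃ {j} z≤ β≤)
    ... | no υ≮z
      with z≤ , υ≤ ← bothShort-sound m ⌈ i /2⌉ ⌊ i /2⌋ (weaken a) (var zero) (weaken y)
             (⇓-weaken a a⇓) refl (⇓-weaken y y⇓)
             (from (if-≮ _ _ _ _ (⇓-weaken y y⇓) refl υ≮z) h)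
      = inj₁ (join-∃ {i} z≤ υ≤)

    bothShort-sound :
      ∀ m i j {n} {ρ : Vec (Fin (suc N)) n} (a x b : Term n) {α ξ β} →
      ρ ⊢ a ⇓ α → ρ ⊢ x ⇓ ξ → ρ ⊢ b ⇓ β →
      Sat (bothShort m i j a x b) ρ → ξ ≤ i + α × β ≤ j + ξ
    bothShort-sound m i j a x b a⇓ x⇓ b⇓ h =
      shortThrough-sound m a x a⇓ x⇓ (λ y _ y<ξ → from
        (if-< _ _ _ _ refl (⇓-weaken x x⇓) y<ξ) (h y)) ,
      shortThrough-sound m x b x⇓ b⇓ (λ y ξ≤y y<β → from
        (if-< _ _ _ _ refl (⇓-weaken b b⇓) y<β) (from
        (if-≮ _ _ _ _ refl (⇓-weaken x x⇓) (≤⇒≯ ξ≤y)) (h y)))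

    -- Only `y` from `α` up to below `β` may be assumed: `bothShort` reaches its second interval
    -- only for `y` not below `x`.
    shortThrough-sound :
      ∀ m {n i} {ρ : Vec (Fin (suc N)) n} (a b : Term n) {α β} →
      ρ ⊢ a ⇓ α → ρ ⊢ b ⇓ β →
      (∀ y → α ≤ toℕ y → toℕ y < β →
        Sat (shortThrough m i (weaken a) (var zero) (weaken b)) (y ∷ ρ)) →
      β ≤ i + α
    shortThrough-sound m {i = zero} a b {α} {β} a⇓ b⇓ h with α <? β
    ... | no α≮β = ≮⇒≥ α≮β
    ... | yes α<β
      -- The clause for 0 ignores `y`, but an instance is still required; the point at `α` supplies
      -- it.
      with y , refl ← element (⇓-bounded a a⇓)
      = ⊥-elim (constant-false (L N) (λ ()) ([∃∀]^ m)
          (from (if-< (weaken a) (weaken b) _ _ (⇓-weaken a a⇓) (⇓-weaken b b⇓) α<β)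
            (h y ≤-refl α<β)))
    shortThrough-sound m {i = suc i} a b {α} {β} a⇓ b⇓ h with suc i + α <? β
    ... | no ≮β = ≮⇒≥ ≮β
    -- If the bound failed, the point `suc (⌈ i /2⌉ + α)` would lie below `β` and refute both
    -- disjuncts.
    ... | yes <β
      with υ<β ← ≤-<-trans (s≤s (+-monoˡ-≤ α (⌈n/2⌉≤n i))) <β
      with y , y⇓ ← element (<-trans υ<β (⇓-bounded b b⇓))
      with oneShort-sound m (weaken a) (var zero) (weaken b)
             (⇓-weaken a a⇓) y⇓ (⇓-weaken b b⇓)
             (h y (≤-trans (m≤n+m α (suc ⌈ i /2⌉)) (≤-reflexive (sym y⇓)))
                  (subst (_< β) (sym y⇓) υ<β))
    ... | inj₁ υ≤ = contradiction υ≤ (<⇒≱ ≤-refl)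
    ... | inj₂ β≤ = contradiction (≤-trans β≤ (≤-reflexive (halves-suc-+ i α))) (<⇒≱ <β)

-- Counting quantifiers

-- The second argument of _⊔_ makes maxLength∀ an upper bound also in the
-- exceptional case q*∀ 2 ≡ 2, and makes it dominate maxLength∃.
mutual
  maxLength∃ maxLength∀ : ℕ → ℕ
  maxLength∃ zero    = 0
  maxLength∃ (suc q) = 2 * maxLength∀ q
  maxLength∀ zero    = 0
  maxLength∀ (suc q) = (1 + 2 * maxLength∃ q) ⊔ (2 * maxLength∀ q)

maxLength∃≤maxLength∀ : ∀ q → maxLength∃ q ≤ maxLength∀ q
maxLength∃≤maxLength∀ zero    = z≤n
maxLength∃≤maxLength∀ (suc q) = m≤n⊔m (1 + 2 * maxLength∃ q) _

≤1+2⌊/2⌋ : ∀ n → n ≤ 1 + 2 * ⌊ n /2⌋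
≤1+2⌊/2⌋ zero          = z≤n
≤1+2⌊/2⌋ (suc zero)    = s≤s z≤n
≤1+2⌊/2⌋ (suc (suc n)) =
  ≤-trans (s≤s (s≤s (≤1+2⌊/2⌋ n))) (≤-reflexive (cong suc (sym (*-suc 2 ⌊ n /2⌋))))

≤2⌈/2⌉ : ∀ n → n ≤ 2 * ⌈ n /2⌉
≤2⌈/2⌉ zero    = z≤n
≤2⌈/2⌉ (suc n) =
  ≤-trans (s≤s (≤1+2⌊/2⌋ n)) (≤-reflexive (sym (*-suc 2 ⌊ n /2⌋)))

-- Each recursive step halves where `maxLength∃` doubles or `maxLength∀` sends c to at least 1 + 2
-- c; only the rounding remains to be checked.
q*-bounds : ∀ ℓ → ℓ ≤ maxLength∃ (q*∃ ℓ) × ℓ ≤ maxLength∀ (q*∀ ℓ)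
q*-bounds = <-rec _ λ ℓ ih → bound∃ ℓ ih , bound∀ ℓ ih
  where
  Bounds : ℕ → Set
  Bounds ℓ = ℓ ≤ maxLength∃ (q*∃ ℓ) × ℓ ≤ maxLength∀ (q*∀ ℓ)

  bound∃ : ∀ ℓ → (∀ {k} → k < ℓ → Bounds k) → ℓ ≤ maxLength∃ (q*∃ ℓ)
  bound∃ 0 _ = z≤n
  bound∃ 1 _ = s≤s z≤n
  bound∃ ℓ@(suc (suc n)) ih
    rewrite q*∃-halve ℓ (s≤s (s≤s z≤n)) | +-comm (q*∀ ⌈ ℓ /2⌉) 1 =
    ≤-trans (≤2⌈/2⌉ ℓ) (*-monoʳ-≤ 2 (proj₂ (ih (⌈n/2⌉<n n))))

  bound∀ : ∀ ℓ → (∀ {k} → k < ℓ → Bounds k) → ℓ ≤ maxLength∀ (q*∀ ℓ)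
  bound∀ 0 _ = z≤n
  bound∀ 1 _ = s≤s z≤n
  bound∀ 2 _ = s≤s (s≤s z≤n)
  bound∀ ℓ@(suc (suc (suc n))) ih
    rewrite q*∀-halve ℓ (s≤s (s≤s (s≤s z≤n))) | +-comm (q*∃ ⌊ ℓ /2⌋) 1 =
    ≤-trans (≤1+2⌊/2⌋ ℓ)
      (≤-trans (s≤s (*-monoʳ-≤ 2 (proj₁ (ih (⌊n/2⌋<n (suc (suc n)))))))
               (m≤m⊔n _ (2 * maxLength∀ (q*∃ ⌊ ℓ /2⌋))))

q*-bound : ∀ ℓ → ℓ ≤ maxLength∀ (q* ℓ)
q*-bound ℓ with ⊓-sel (q*∃ ℓ) (q*∀ ℓ)
... | inj₁ e rewrite e = ≤-trans (proj₁ (q*-bounds ℓ)) (maxLength∃≤maxLength∀ (q*∃ ℓ))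
... | inj₂ e rewrite e = proj₂ (q*-bounds ℓ)

mutual
  -- With c = `capacity m`, the maxima compare 1 + 2 c with 2 c at odd arguments and 1 + 4 c with 2
  -- + 4 c at positive even ones. The winner is always the alternation that ends with ∀.
  maxLength-even : ∀ m → maxLength∃ (m * 2) ≡ capacity m × maxLength∀ (m * 2) ≡ capacity m
  maxLength-even zero = refl , refl
  maxLength-even (suc m)
    rewrite maxLength∀-odd m | proj₂ (maxLength-even m) = refl ,
      m≤n⇒m⊔n≡n (*-monoʳ-< 2 (n<1+n (2 * capacity m)))

  maxLength∀-odd : ∀ m → maxLength∀ (suc (m * 2)) ≡ 1 + 2 * capacity m
  maxLength∀-odd m
    rewrite proj₁ (maxLength-even m) | proj₂ (maxLength-even m) =
      m≥n⇒m⊔n≡m (n≤1+n (2 * capacity m))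

parity : ∀ q → ∃[ m ] (q ≡ m * 2 ⊎ q ≡ suc (m * 2))
parity zero = 0 , inj₁ refl
parity (suc q) with parity q
... | m , inj₁ refl = m , inj₂ refl
... | m , inj₂ refl = suc m , inj₁ refl

-- The separating sentences

separates : ∀ σ {ℓ} → (∀ N → L N ⊨ σ ⇔ N ≤ ℓ) → Separates σ (L≤ ℓ) (L> ℓ)
separates σ e =
  (λ { _ (N , _ , N≤ℓ , refl) → from (e N) N≤ℓ }) ,
  (λ { _ (N , N>ℓ , refl) s → <⇒≱ N>ℓ (to (e N) s) })

-- The first interval is degenerate, from `minᵗ` to itself with bound 0, so only the bound from
-- `minᵗ` to `maxᵗ` has content.
∀-sentence : ℕ → ∀ m → PrenexFormula (∀[∃∀]^ m) 0
∀-sentence ℓ m = bothShort m 0 ℓ minᵗ minᵗ maxᵗ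

∀-sentence-defines : ∀ ℓ m → ℓ ≤ 1 + 2 * capacity m → ∀ N → L N ⊨ proj₁ (∀-sentence ℓ m) ⇔ N ≤ ℓ
∀-sentence-defines ℓ m ℓ≤ N = mk⇔
  (λ s → ≤-trans (proj₂ (bothShort-sound N m 0 ℓ minᵗ minᵗ maxᵗ refl refl (toℕ-fromℕ N) s))
           (≤-reflexive (+-identityʳ ℓ)))
  (λ N≤ℓ → bothShort-complete N m 0 ℓ minᵗ minᵗ maxᵗ refl refl (toℕ-fromℕ N) z≤n ℓ≤ z≤n
             (≤-trans N≤ℓ (m≤m+n ℓ 0)))

∃-sentence : ℕ → ∀ m → PrenexFormula ([∃∀]^ suc m) 0
∃-sentence ℓ m = quantify ∃ᑫ (bothShort m ⌈ ℓ /2⌉ ⌊ ℓ /2⌋ minᵗ (var zero) maxᵗ)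

∃-sentence-defines : ∀ ℓ m → ℓ ≤ capacity (suc m) → ∀ N → L N ⊨ proj₁ (∃-sentence ℓ m) ⇔ N ≤ ℓ
∃-sentence-defines ℓ m ℓ≤ N = mk⇔ sound complete
  where
  sound : L N ⊨ proj₁ (∃-sentence ℓ m) → N ≤ ℓ
  sound (z , s) with z≤ , N≤ ← bothShort-sound N m ⌈ ℓ /2⌉ ⌊ ℓ /2⌋ minᵗ (var zero) maxᵗ refl refl (toℕ-fromℕ N) s
    = ≤-trans (join-∃ {ℓ} z≤ N≤) (≤-reflexive (+-identityʳ ℓ))

  complete : N ≤ ℓ → L N ⊨ proj₁ (∃-sentence ℓ m)
  complete N≤ℓ with z , z⇓ ← element N (s≤s (m⊓n≤n (⌈ ℓ /2⌉ + 0) N))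
    = z , bothShort-complete N m ⌈ ℓ /2⌉ ⌊ ℓ /2⌋ minᵗ (var zero) maxᵗ refl z⇓ (toℕ-fromℕ N)
            (⌈n/2⌉≤ ℓ≤) (⌊n/2⌋≤ ℓ≤)
            (m⊓n≤m (⌈ ℓ /2⌉ + 0) N) (split-∃ {ℓ} (≤-trans N≤ℓ (m≤m+n ℓ 0)))

mainTheorem4 : ∀ (ℓ : ℕ) → 1 ≤ ℓ →
    Σ[ σ ∈ Sentence ] ∃[ Q ]
    Prenex Q σ
    × #quantifiers σ ≡ q* ℓ
    × Separates σ (L≤ ℓ) (L> ℓ)
    × Linked _≢_ Q
    × last Q ≡ just ∀ᑫ
-- As the prefix must end with ∀, parity fixes its first quantifier: ∃ for an even number, ∀ for an
-- odd one. Zero quantifiers would force `ℓ` to be 0.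
mainTheorem4 ℓ 1≤ℓ with q* ℓ | q*-bound ℓ | parity (q* ℓ)
... | _ | ℓ≤ | zero , inj₁ refl = contradiction (≤-trans 1≤ℓ ℓ≤) λ ()
... | _ | ℓ≤ | suc m , inj₁ refl =
  proj₁ (∃-sentence ℓ m) , _ , prenex ,
  trans (#quantifiers-prenex prenex) (cong suc (∀[∃∀]-length m)) ,
  separates (proj₁ (∃-sentence ℓ m)) (∃-sentence-defines ℓ m
    (≤-trans ℓ≤ (≤-reflexive (proj₂ (maxLength-even (suc m)))))) ,
  (λ ()) ∷ ∀[∃∀]-linked m ,
  ∀[∃∀]-last m
  where prenex = proj₂ (∃-sentence ℓ m)
... | _ | ℓ≤ | m , inj₂ refl =
  proj₁ (∀-sentence ℓ m) , _ , prenex ,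
  trans (#quantifiers-prenex prenex) (∀[∃∀]-length m) ,
  separates (proj₁ (∀-sentence ℓ m)) (∀-sentence-defines ℓ m (≤-trans ℓ≤ (≤-reflexive (maxLength∀-odd m)))) ,
  ∀[∃∀]-linked m ,
  ∀[∃∀]-last m
  where prenex = proj₂ (∀-sentence ℓ m)
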